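{- Every graph $G$ satisfies \[\chi_{\mathrm{cen}}(G)\leq c\cdot(\mathrm{tw}(G)+1)\cdot\left(\chi_{\mathrm{lin}}(G)+\frac{1}{\log 3}\right),\] where $c=\alpha\log 3<3.7$ and $\alpha=\log 3/\log\left(\frac{1+\sqrt5}{2}\right)$.
   Context: All graphs are finite and simple; logarithms are binary. $\mathrm{tw}(G)$ is the treewidth of $G$. A centered coloring of $G$ assigns integers (colors) to vertices so that every connected subgraph contains a vertex whose color is unique in that subgraph; $\chi_{\mathrm{cen}}(G)$ is the minimum number of colors of such a coloring. A linear coloring requires the same only for every path of $G$ (as a subgraph); $\chi_{\mathrm{lin}}(G)$ is the minimum number of colors of a linear coloring. -}

module Defs where

open import Data.Nat using (ℕ; zero; suc; _+_; _*_; _∸_; _^_; _≤_)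
open import Data.Fin using (Fin)
open import Data.Fin.Subset using (Subset; _∈_; ∣_∣)
open import Data.List using (List; []; _∷_; length)
open import Data.List.Relation.Unary.Unique.Propositional using (Unique)
import Data.List.Membership.Propositional as LM
open import Data.Product using (Σ; ∃; _×_)
open import Relation.Nullary using (¬_)
open import Relation.Binary.PropositionalEquality using (_≡_)

record Graph (n : ℕ) : Set₁ where
  field
    _~_     : Fin n → Fin n → Set
    sym~    : ∀ {u v} → u ~ v → v ~ u
    irrefl~ : ∀ {u} → ¬ (u ~ u)
open Graph public

data Walk {n : ℕ} (R : Fin n → Fin n → Set) : Fin n → Fin n → Set where
  []  : ∀ {u} → Walk R u u
  _∷_ : ∀ {u v w} → R u v → Walk R v w → Walk R u w

data Chain {n : ℕ} (R : Fin n → Fin n → Set) : List (Fin n) → Set where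
  one  : ∀ v → Chain R (v ∷ [])
  step : ∀ {u v vs} → R u v → Chain R (v ∷ vs) → Chain R (u ∷ v ∷ vs)

IsPath : ∀ {n} → Graph n → List (Fin n) → Set
IsPath G vs = Chain (_~_ G) vs × Unique vs

lastOf : ∀ {n} → Fin n → List (Fin n) → Fin n
lastOf x []       = x
lastOf x (y ∷ ys) = lastOf y ys

IsCycle : ∀ {n} → Graph n → List (Fin n) → Set
IsCycle G []       = Data.Empty.⊥ where import Data.Empty
IsCycle G (v ∷ vs) = IsPath G (v ∷ vs) × (3 ≤ length (v ∷ vs)) × (_~_ G (lastOf v vs) v)

-- a tree: connected and acyclic (nonemptiness is built in via Fin (suc m))
IsTree : ∀ {m} → Graph (suc m) → Set
IsTree T = (∀ u v → Walk (_~_ T) u v) × (∀ vs → ¬ IsCycle T vs)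

record Subgraph {n : ℕ} (G : Graph n) : Set₁ where
  field
    V      : Subset n
    E      : Fin n → Fin n → Set
    E⊆     : ∀ {u v} → E u v → _~_ G u v
    E-sym  : ∀ {u v} → E u v → E v u
    E-ends : ∀ {u v} → E u v → (u ∈ V) × (v ∈ V)
open Subgraph public

IsConnected : ∀ {n} {G : Graph n} → Subgraph G → Set
IsConnected H = (∃ λ v → v ∈ V H) × (∀ u v → u ∈ V H → v ∈ V H → Walk (E H) u v)

IsCentered : ∀ {n k} (G : Graph n) → (Fin n → Fin k) → Set₁
IsCentered G col =
  ∀ (H : Subgraph G) → IsConnected H →
    ∃ λ v → (v ∈ V H) × (∀ w → w ∈ V H → col w ≡ col v → w ≡ v)

IsLinear : ∀ {n k} (G : Graph n) → (Fin n → Fin k) → Set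
IsLinear G col =
  ∀ vs → IsPath G vs →
    ∃ λ v → (v LM.∈ vs) × (∀ w → w LM.∈ vs → col w ≡ col v → w ≡ v)

IsChiCen : ∀ {n} → Graph n → ℕ → Set₁
IsChiCen {n} G k =
  (Σ (Fin n → Fin k) (IsCentered G)) ×
  (∀ s → Σ (Fin n → Fin s) (IsCentered G) → k ≤ s)

IsChiLin : ∀ {n} → Graph n → ℕ → Set
IsChiLin {n} G L =
  (Σ (Fin n → Fin L) (IsLinear G)) ×
  (∀ s → Σ (Fin n → Fin s) (IsLinear G) → L ≤ s)

record TreeDecomposition {n : ℕ} (G : Graph n) : Set₁ where
  field
    m         : ℕ
    T         : Graph (suc m)
    isTree    : IsTree T
    bag       : Fin (suc m) → Subset n
    cover     : ∀ v → ∃ λ i → v ∈ bag i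
    edgeCover : ∀ u v → _~_ G u v → ∃ λ i → (u ∈ bag i) × (v ∈ bag i)
    coherent  : ∀ v i j → v ∈ bag i → v ∈ bag j →
                Walk (λ a b → _~_ T a b × (v ∈ bag b)) i j
open TreeDecomposition public

BagsAtMost : ∀ {n} {G : Graph n} → TreeDecomposition G → ℕ → Set
BagsAtMost D s = ∀ i → ∣ bag D i ∣ ≤ s

IsTwPlusOne : ∀ {n} → Graph n → ℕ → Set₁
IsTwPlusOne G t =
  (Σ (TreeDecomposition G) λ D → BagsAtMost D t) ×
  (∀ s → Σ (TreeDecomposition G) (λ D → BagsAtMost D s) → t ≤ s)

fib : ℕ → ℕ
fib zero          = 0
fib (suc zero)    = 1
fib (suc (suc n)) = fib (suc n) + fib n

lucas : ℕ → ℕ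
lucas zero          = 2
lucas (suc zero)    = 1
lucas (suc (suc n)) = lucas (suc n) + lucas n

-- 2^p ≤ φ^q, using φ^q = (lucas q + fib q · √5)/2, i.e.
-- 2^(p+1) − lucas q ≤ fib q · √5   (trivial when the left side is ≤ 0).
-- Equivalently (q > 0):  p/q ≤ log φ.
TwoPowLePhiPow : ℕ → ℕ → Set
TwoPowLePhiPow p q =
  (2 ^ suc p ∸ lucas q) * (2 ^ suc p ∸ lucas q) ≤ 5 * (fib q * fib q)

-- For b > 0:  log 3 ≤ a/b  ⇔  3^b ≤ 2^a.
Log3LeFrac : ℕ → ℕ → Set
Log3LeFrac a b = 3 ^ b ≤ 2 ^ a

-- CenBound k t L  ⇔  k ≤ c · t · (L + 1/log 3)  with c = α log 3, α = log 3 / log φ,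
-- i.e.  k · log φ ≤ log 3 · t · (L · log 3 + 1).
-- Stated as: for all rationals u = a/b ≥ log 3 and v = p/q ≤ log φ,
--   k · v ≤ u · t · (L · u + 1), i.e. k·p·b² ≤ q·a·t·(L·a + b).
-- (Equivalent by density of ℚ and monotonicity of both sides.)
CenBound : ℕ → ℕ → ℕ → Set
CenBound k t L =
  ∀ a b p q → 1 ≤ b → 1 ≤ q → Log3LeFrac a b → TwoPowLePhiPow p q →
    k * p * (b * b) ≤ q * a * t * (L * a + b)

{-# OPTIONS --safe #-}

-- Call a connected vertex set of rank 0, and of rank d + 1 if it contains two disjoint sets of
-- rank d.
--
-- If no set has rank d and G has a tree decomposition with bags of size at most t, then d t colours
-- suffice for a centered coloring: inside a component without sets of rank d + 1 the sets of rank d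
-- pairwise intersect, so by the Helly property some bag meets them all; give its vertices private
-- colours and recurse.
--
-- A set of rank d contains a binary tree, rooted anywhere in it, with at least (3/2)^d nodes having
-- at most one child: join the trees of the two halves by a path, and where this would create a third
-- child, drop the smaller of the two old branches. In a linear coloring with L colours there are
-- at most 3^L such nodes: give every node a vector in {0,1,2}^L by letting each vertex of colour c
-- on the path from the root act on coordinate c by a transposition of 0 with 1 or 2 that depends on
-- where the path continues; the centre of the path between two nodes shows that their vectors differ.
--
-- Hence no set has rank 3L + 1 and χ_cen ≤ (3L + 1) t, which is below the claimed bound because
-- log 3 ≥ 3/2 and log φ ≤ 3/4.
module Submission where

open import Defs
open import Data.Bool using (Bool; true; false)
open import Data.Empty using (⊥-elim)
open import Data.Fin using (Fin; zero; suc; funToFin; finToFun; fromℕ<)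
open import Data.Fin.Properties using (_≟_; any?; sequence; injective⇒≤; finToFun-funToFin; fromℕ<-injective)
open import Data.Fin.Subset using (Subset; _∈_; _∉_; _⊆_; Nonempty; ∣_∣; _∩_; _─_; _-_; ⁅_⁆; ⊤; inside; outside)
open import Data.Fin.Subset.Properties
open import Data.List using (List; []; _∷_; length; map; _++_; _ʳ++_; lookup)
open import Data.List.Membership.DecPropositional using () renaming (_∈?_ to mem?)
open import Data.List.Membership.Propositional using () renaming (_∈_ to _∈ₗ_; _∉_ to _∉ₗ_)
open import Data.List.Membership.Propositional.Properties using (∈-++⁺ˡ; ∈-++⁺ʳ; ∈-++⁻; ∈-lookup)
open import Data.List.Properties using (length-map; length-++)
open import Data.List.Relation.Unary.All as All using (All; []; _∷_)
import Data.List.Relation.Unary.All.Properties as All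
open import Data.List.Relation.Unary.AllPairs as AllPairs using (AllPairs; []; _∷_)
import Data.List.Relation.Unary.AllPairs.Properties as AllPairs
open import Data.List.Relation.Unary.Any using (here; there)
open import Data.List.Relation.Unary.Unique.Propositional using (Unique)
open import Data.List.Relation.Unary.Unique.Propositional.Properties using (Unique[x∷xs]⇒x∉xs)
open import Data.Nat using (ℕ; zero; suc; _+_; _*_; _∸_; _^_; _≤_; _<_; z≤n; s≤s; _≤?_; _<?_)
open import Data.Nat.Properties hiding (_≟_; _≤?_; _<?_)
open import Data.Nat.Solver using (module +-*-Solver)
open import Data.Product using (Σ; ∃; ∃₂; _×_; _,_; proj₁; proj₂)
open import Data.Sum using (_⊎_; inj₁; inj₂; [_,_]′)
open import Data.Vec using (tabulate; _∷_; there)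
open import Data.Vec.Properties using (lookup∘tabulate; []=⇒lookup; lookup⇒[]=)
open import Effect.Monad using (RawMonad)
open import Function using (_∘_; id)
open import Relation.Binary.PropositionalEquality
open import Relation.Nullary using (¬_; Dec; yes; no; does; contradiction; ¬¬-excluded-middle)
open import Relation.Nullary.Decidable using (_⊎-dec_; decidable-stable; from-yes)
open import Relation.Nullary.Negation using (¬¬-Monad)
open import Relation.Unary using (Decidable)

-- Walks and simple paths

variable
  n : ℕ
  R Q : Fin n → Fin n → Set
  u v w : Fin n

infixr 5 _◅◅_
_◅◅_ : Walk R u v → Walk R v w → Walk R u w
[]      ◅◅ q = q
(r ∷ p) ◅◅ q = r ∷ (p ◅◅ q)

map-walk : (∀ {a b} → R a b → Q a b) → Walk R u v → Walk Q u v
map-walk f []      = []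
map-walk f (r ∷ p) = f r ∷ map-walk f p

reverse-walk : (∀ {a b} → R a b → R b a) → Walk R u v → Walk R v u
reverse-walk s []      = []
reverse-walk s (r ∷ p) = reverse-walk s p ◅◅ (s r ∷ [])

map-chain : (∀ {a b} → R a b → Q a b) → ∀ {vs} → Chain R vs → Chain Q vs
map-chain f (one v)    = one v
map-chain f (step r c) = step (f r) (map-chain f c)

record SimplePath {n : ℕ} (R : Fin n → Fin n → Set) (u v : Fin n) : Set where
  constructor simple
  field
    rest   : List (Fin n)
    chain  : Chain R (u ∷ rest)
    unique : Unique (u ∷ rest)
    ends   : lastOf u rest ≡ v

suffix-from : ((simple vs _ _ _) : SimplePath R u v) → w ∈ₗ (u ∷ vs) → SimplePath R w v
suffix-from p (here refl) = p
suffix-from (simple (_ ∷ vs) (step _ c) (_ ∷ d) e) (there i) = suffix-from (simple vs c d e) i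

prefix-to : ((simple vs _ _ _) : SimplePath R u v) → w ∈ₗ (u ∷ vs) →
  Σ (SimplePath R u w) λ p → ∀ {x} → x ∈ₗ (u ∷ SimplePath.rest p) → x ∈ₗ (u ∷ vs)
prefix-to (simple vs c d e) (here refl) = simple [] (one _) ([] ∷ []) refl , λ { (here x) → here x ; (there ()) }
prefix-to (simple (_ ∷ vs) (step r c) (a ∷ d) e) (there i) with prefix-to (simple vs c d e) i
... | simple ws c' d' e' , sub =
  simple (_ ∷ ws) (step r c') (All.tabulate (All.lookup a ∘ sub) ∷ d') e' ,
  λ { (here x) → here x ; (there x) → there (sub x) }

erase-loops : Walk R u v → SimplePath R u v
erase-loops [] = simple [] (one _) ([] ∷ []) refl
erase-loops {u = u} (r ∷ p) with erase-loops p
... | q@(simple vs c d e) with mem? _≟_ u (_ ∷ vs)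
...   | yes i = suffix-from q i
...   | no ∉  = simple (_ ∷ vs) (step r c) (All.tabulate (λ { i refl → ∉ i }) ∷ d) e

-- Only the source of each step has to miss `P`, because the last step enters `P`. Walks of this
-- shape are what `graft` takes.
cut-at-first : {P : Fin n → Set} → Decidable P → Walk R u v → P v →
  ∃ λ y → P y × Walk (λ a b → R a b × ¬ P a) u y
cut-at-first P? []      pv = _ , pv , []
cut-at-first {u = u} P? (r ∷ p) pv with P? u
... | yes pu = u , pu , []
... | no ¬pu with cut-at-first P? p pv
...   | y , py , q = y , py , (r , ¬pu) ∷ q

Outside : {n : ℕ} → (Fin n → Set) → (Fin n → Fin n → Set) → Fin n → Fin n → Set
Outside P R a b = R a b × ¬ P a × ¬ P b

LastExit : {n : ℕ} → (Fin n → Set) → (Fin n → Fin n → Set) → Fin n → Set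
LastExit P R v = ∃₂ λ z z′ → P z × R z z′ × ¬ P z′ × Walk (Outside P R) z′ v

last-exit : {P : Fin n → Set} → Decidable P → Walk R u v → P u → ¬ P v → LastExit P R v
last-exit {n} {R} {u} {v} {P} P? walk pu ¬pv = [ (λ (¬pu , _) → contradiction pu ¬pu) , id ]′ (go walk)
  where
  -- The recursion cannot keep the hypothesis `P u`; the left alternative covers the tails that
  -- never meet `P`.
  go : ∀ {u} → Walk R u v → (¬ P u × Walk (Outside P R) u v) ⊎ LastExit P R v
  go [] = inj₁ (¬pv , [])
  go {u} (r ∷ p) with go p
  ... | inj₂ e = inj₂ e
  ... | inj₁ (¬pb , q) with P? u
  ...   | yes pu = inj₂ (u , _ , pu , r , ¬pb , q)
  ...   | no ¬pu = inj₁ (¬pu , (r , ¬pu , ¬pb) ∷ q)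

unique⇒length≤ : ∀ {m} {xs : List (Fin m)} → Unique xs → length xs ≤ m
unique⇒length≤ {xs = xs} d = injective⇒≤ (lookup-injective d)
  where
  lookup-injective : ∀ {xs} → Unique xs → ∀ {i j} → lookup xs i ≡ lookup xs j → i ≡ j
  lookup-injective (a ∷ d) {zero}  {zero}  eq = refl
  lookup-injective (a ∷ d) {zero}  {suc j} eq = contradiction eq (All.lookup a (∈-lookup j))
  lookup-injective (a ∷ d) {suc i} {zero}  eq = contradiction (sym eq) (All.lookup a (∈-lookup i))
  lookup-injective (a ∷ d) {suc i} {suc j} eq = cong suc (lookup-injective d eq)

-- Sets of given rank and the binary trees in them

module Rank {n : ℕ} (G : Graph n) where

  infix 4 _–_
  _–_ : Fin n → Fin n → Set
  _–_ = _~_ G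

  Within : Subset n → Fin n → Fin n → Set
  Within S a b = a ∈ S × b ∈ S × a – b

  within-sym : ∀ {S a b} → Within S a b → Within S b a
  within-sym (a∈ , b∈ , e) = b∈ , a∈ , sym~ G e

  Connected : Subset n → Set
  Connected S = Nonempty S × (∀ u v → u ∈ S → v ∈ S → Walk (Within S) u v)

  Disjoint : Subset n → Subset n → Set
  Disjoint A B = ∀ {x} → x ∈ A → x ∉ B

  HasRank : ℕ → Subset n → Set
  HasRank zero    S = Connected S
  HasRank (suc d) S = Connected S × ∃₂ λ A B →
    A ⊆ S × B ⊆ S × Disjoint A B × HasRank d A × HasRank d B

  rank⇒connected : ∀ d {S} → HasRank d S → Connected S
  rank⇒connected zero    c = c
  rank⇒connected (suc d) (c , _) = c

  data Tree : Fin n → Set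
  verts : ∀ {r} → Tree r → List (Fin n)

  data Tree where
    leaf : ∀ r → Tree r
    one  : ∀ {r w} → r – w → (T : Tree w) → r ∉ₗ verts T → Tree r
    two  : ∀ {r w w′} → r – w → r – w′ → (T : Tree w) (T′ : Tree w′) →
           r ∉ₗ verts T → r ∉ₗ verts T′ →
           (∀ {x} → x ∈ₗ verts T → x ∉ₗ verts T′) → Tree r

  verts (leaf r)               = r ∷ []
  verts (one {r} _ T _)        = r ∷ verts T
  verts (two {r} _ _ T T′ _ _ _) = r ∷ verts T ++ verts T′

  root∈ : ∀ {r} (T : Tree r) → r ∈ₗ verts T
  root∈ (leaf r)            = here refl
  root∈ (one _ _ _)         = here refl
  root∈ (two _ _ _ _ _ _ _) = here refl

  -- A branching node is not counted: its two labels are used up by its children, so none is left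
  -- for a route ending there.
  size : ∀ {r} → Tree r → ℕ
  size (leaf r)              = 1
  size (one _ T _)           = suc (size T)
  size (two _ _ T T′ _ _ _)  = size T + size T′

  size>0 : ∀ {r} (T : Tree r) → 1 ≤ size T
  size>0 (leaf r)             = s≤s z≤n
  size>0 (one _ T _)          = s≤s z≤n
  size>0 (two _ _ T _ _ _ _)  = ≤-trans (size>0 T) (m≤m+n _ _)

  -- After loop erasure the path vertices before `y` become one-child nodes above `T`, so the size
  -- cannot drop. They miss `Y` while `T` lies in `Y`, hence no vertex is repeated. New vertices are
  -- described as sources of `R`-steps, so that a caller can read off from `R` where they lie.
  graft : ∀ {u y} {Y : Fin n → Set} → (∀ {a b} → R a b → a – b × ¬ Y a) →
    Walk R u y → (T : Tree y) → (∀ {x} → x ∈ₗ verts T → Y x) →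
    Σ (Tree u) λ T′ → size T ≤ size T′ ×
      (∀ {x} → x ∈ₗ verts T′ → (∃ λ b → R x b) ⊎ x ∈ₗ verts T)
  graft {R = R} {y = y} {Y = Y} R⇒ walk T T⊆Y =
    let simple _ c d e = erase-loops walk
        T′ , le , sub  = along c d e
    in T′ , le , λ x∈ → [ inj₁ ∘ proj₂ , inj₂ ]′ (sub x∈)
    where
    along : ∀ {u vs} → Chain R (u ∷ vs) → Unique (u ∷ vs) → lastOf u vs ≡ y →
      Σ (Tree u) λ T′ → size T ≤ size T′ ×
        (∀ {x} → x ∈ₗ verts T′ → (x ∈ₗ (u ∷ vs) × ∃ λ b → R x b) ⊎ x ∈ₗ verts T)
    along (one _) _ refl = T , ≤-refl , inj₂
    along (step {u} r c) (a ∷ d) e with along c d e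
    ... | T′ , le , sub = one (proj₁ (R⇒ r)) T′ u∉ , m≤n⇒m≤1+n le , sub′
      where
      u∉ : u ∉ₗ verts T′
      u∉ u∈ = [ (λ (u∈vs , _) → Unique[x∷xs]⇒x∉xs (a ∷ d) u∈vs) , (λ u∈T → proj₂ (R⇒ r) (T⊆Y u∈T)) ]′ (sub u∈)
      sub′ : ∀ {x} → x ∈ₗ (u ∷ verts T′) → _
      sub′ (here refl) = inj₁ (here refl , _ , r)
      sub′ (there x∈)  = [ (λ (i , b) → inj₁ (there i , b)) , inj₂ ]′ (sub x∈)

  -- All of `U` counts and at most half of `T` is lost; two trees of size at least (3/2)^d thus give
  -- one of size at least (3/2)^(d + 1).
  Attached : ∀ {r u} → Tree r → Tree u → Set
  Attached {r} T U = Σ (Tree r) λ T′ → size T + 2 * size U ≤ 2 * size T′ ×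
    (∀ {x} → x ∈ₗ verts T′ → x ∈ₗ verts T ⊎ x ∈ₗ verts U)

  -- If z already has two children, the smaller of the two subtrees is dropped.
  attach : ∀ {r z u} (T : Tree r) (U : Tree u) → z ∈ₗ verts T → z – u →
    (∀ {x} → x ∈ₗ verts T → x ∉ₗ verts U) → Attached T U
  attach (leaf z) U (here refl) e dis =
    one e U (dis (here refl)) , ≤-trans (n≤1+n _) (≤-reflexive (sym (*-distribˡ-+ 2 1 (size U)))) ,
    λ { (here x) → inj₁ (here x) ; (there x) → inj₂ x }
  -- Here `z` becomes branching and is no longer counted; `size>0 T` pays for this loss.
  attach (one f T z∉) U (here refl) e dis =
    two f e T U z∉ (dis (here refl)) (dis ∘ there) ,
    ≤-trans (+-monoˡ-≤ (2 * size U) (≤-trans (+-monoˡ-≤ (size T) (size>0 T)) (≤-reflexive (cong (size T +_) (sym (+-identityʳ _))))))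
            (≤-reflexive (sym (*-distribˡ-+ 2 (size T) (size U)))) ,
    λ { (here x) → inj₁ (here x) ; (there x) → [ inj₁ ∘ there , inj₂ ]′ (∈-++⁻ (verts T) x) }
  attach (one {r} f T r∉) U (there z∈) e dis with attach T U z∈ e (dis ∘ there)
  ... | T′ , le , sub =
    one f T′ (λ r∈ → [ r∉ , dis (here refl) ]′ (sub r∈)) ,
    ≤-trans (s≤s le) (≤-trans (n≤1+n _) (≤-reflexive (sym (*-distribˡ-+ 2 1 (size T′))))) ,
    λ { (here x) → inj₁ (here x) ; (there x) → [ inj₁ ∘ there , inj₂ ]′ (sub x) }
  attach (two f g T₁ T₂ r∉₁ r∉₂ d) U (here refl) e dis with ≤-total (size T₁) (size T₂)
  ... | inj₁ le =
    two g e T₂ U r∉₂ (dis (here refl)) (dis ∘ there ∘ ∈-++⁺ʳ (verts T₁)) ,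
    ≤-trans (+-monoˡ-≤ (2 * size U) (+-mono-≤ le (≤-reflexive (sym (+-identityʳ _)))))
            (≤-reflexive (sym (*-distribˡ-+ 2 (size T₂) (size U)))) ,
    λ { (here x) → inj₁ (here x) ; (there x) → [ inj₁ ∘ there ∘ ∈-++⁺ʳ (verts T₁) , inj₂ ]′ (∈-++⁻ (verts T₂) x) }
  ... | inj₂ le =
    two f e T₁ U r∉₁ (dis (here refl)) (dis ∘ there ∘ ∈-++⁺ˡ) ,
    ≤-trans (+-monoˡ-≤ (2 * size U) (+-monoʳ-≤ (size T₁) (≤-trans le (≤-reflexive (sym (+-identityʳ _))))))
            (≤-reflexive (sym (*-distribˡ-+ 2 (size T₁) (size U)))) ,
    λ { (here x) → inj₁ (here x) ; (there x) → [ inj₁ ∘ there ∘ ∈-++⁺ˡ , inj₂ ]′ (∈-++⁻ (verts T₁) x) }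
  attach (two {r} f g T₁ T₂ r∉₁ r∉₂ d) U (there z∈) e dis with ∈-++⁻ (verts T₁) z∈
  ... | inj₁ z∈₁ with attach T₁ U z∈₁ e (dis ∘ there ∘ ∈-++⁺ˡ)
  ...   | T′ , le , sub =
    two f g T′ T₂ (λ r∈ → [ r∉₁ , dis (here refl) ]′ (sub r∈)) r∉₂
      (λ x∈ x∈₂ → [ (λ x∈₁ → d x∈₁ x∈₂) , dis (there (∈-++⁺ʳ (verts T₁) x∈₂)) ]′ (sub x∈)) ,
    (begin
      size T₁ + size T₂ + 2 * size U    ≡⟨ solve 3 (λ a b c → a :+ b :+ con 2 :* c := a :+ con 2 :* c :+ b) refl (size T₁) (size T₂) (size U) ⟩
      size T₁ + 2 * size U + size T₂    ≤⟨ +-mono-≤ le (m≤m+n (size T₂) _) ⟩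
      2 * size T′ + 2 * size T₂         ≡⟨ *-distribˡ-+ 2 (size T′) (size T₂) ⟨
      2 * (size T′ + size T₂)           ∎) ,
    λ { (here x) → inj₁ (here x)
      ; (there x) → [ (λ x∈ → [ inj₁ ∘ there ∘ ∈-++⁺ˡ , inj₂ ]′ (sub x∈)) , inj₁ ∘ there ∘ ∈-++⁺ʳ (verts T₁) ]′ (∈-++⁻ (verts T′) x) }
    where open ≤-Reasoning
          open +-*-Solver
  attach (two {r} f g T₁ T₂ r∉₁ r∉₂ d) U (there z∈) e dis | inj₂ z∈₂ with attach T₂ U z∈₂ e (dis ∘ there ∘ ∈-++⁺ʳ (verts T₁))
  ...   | T′ , le , sub =
    two f g T₁ T′ r∉₁ (λ r∈ → [ r∉₂ , dis (here refl) ]′ (sub r∈))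
      (λ x∈₁ x∈ → [ d x∈₁ , dis (there (∈-++⁺ˡ x∈₁)) ]′ (sub x∈)) ,
    (begin
      size T₁ + size T₂ + 2 * size U    ≡⟨ +-assoc (size T₁) _ _ ⟩
      size T₁ + (size T₂ + 2 * size U)  ≤⟨ +-mono-≤ (m≤m+n (size T₁) _) le ⟩
      2 * size T₁ + 2 * size T′         ≡⟨ *-distribˡ-+ 2 (size T₁) (size T′) ⟨
      2 * (size T₁ + size T′)           ∎) ,
    λ { (here x) → inj₁ (here x)
      ; (there x) → [ inj₁ ∘ there ∘ ∈-++⁺ˡ , (λ x∈ → [ inj₁ ∘ there ∘ ∈-++⁺ʳ (verts T₁) , inj₂ ]′ (sub x∈)) ]′ (∈-++⁻ (verts T₁) x) }
    where open ≤-Reasoning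

  BigTree : ℕ → Subset n → Fin n → Set
  BigTree d S r = Σ (Tree r) λ T → (∀ {x} → x ∈ₗ verts T → x ∈ S) × 3 ^ d ≤ 2 ^ d * size T

  private
    -- A walk from `r` is cut at its first vertex in `B`, then at its last exit from `X`. What
    -- remains misses both, so it can be grafted onto a tree in `B` and attached to `X`. The entry
    -- point into `B` is not under control, which is why trees with every root in `B` are required.
    combine : ∀ d {S B r} → Connected S → B ⊆ S →
      Nonempty B → (∀ {y} → y ∈ B → BigTree d B y) →
      r ∈ S → (X : Tree r) → (∀ {x} → x ∈ₗ verts X → x ∈ S) → (∀ {x} → x ∈ₗ verts X → x ∉ B) →
      3 ^ d ≤ 2 ^ d * size X → BigTree (suc d) S r
    combine d {S} {B} {r} (_ , conn) B⊆S (b , b∈B) trees r∈S X X⊆S X∩B sizeX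
      with cut-at-first (_∈? B) (conn r b r∈S (B⊆S b∈B)) b∈B
    ... | y , y∈B , walk with last-exit (λ x → mem? _≟_ x (verts X)) walk (root∈ X) (λ y∈X → X∩B y∈X y∈B) | trees y∈B
    ... | z , z′ , z∈X , ((_ , _ , e) , _) , _ , walk′ | Tᵧ , Tᵧ⊆B , sizeTᵧ
      with graft (λ (((_ , _ , e) , a∉B) , _) → e , a∉B) walk′ Tᵧ Tᵧ⊆B
    ... | U , sizeU , subU with attach X U z∈X e
            (λ x∈X x∈U → [ (λ (_ , _ , x∉X , _) → x∉X x∈X) , (λ x∈T → X∩B x∈X (Tᵧ⊆B x∈T)) ]′ (subU x∈U))
    ... | T , sizeT , subT = T , T⊆S , bound
      where
      T⊆S : ∀ {x} → x ∈ₗ verts T → x ∈ S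
      T⊆S x∈ = [ X⊆S , (λ x∈U → [ (λ (_ , (((x∈S , _) , _) , _)) → x∈S) , B⊆S ∘ Tᵧ⊆B ]′ (subU x∈U)) ]′ (subT x∈)
      open ≤-Reasoning
      open +-*-Solver
      bound : 3 ^ suc d ≤ 2 ^ suc d * size T
      bound = begin
        3 ^ d + 2 * 3 ^ d                         ≤⟨ +-mono-≤ sizeX (*-monoʳ-≤ 2 (≤-trans sizeTᵧ (*-monoʳ-≤ (2 ^ d) sizeU))) ⟩
        2 ^ d * size X + 2 * (2 ^ d * size U)     ≡⟨ solve 3 (λ p x u → p :* x :+ con 2 :* (p :* u) := p :* (x :+ con 2 :* u)) refl (2 ^ d) (size X) (size U) ⟩
        2 ^ d * (size X + 2 * size U)             ≤⟨ *-monoʳ-≤ (2 ^ d) sizeT ⟩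
        2 ^ d * (2 * size T)                      ≡⟨ solve 2 (λ p t → p :* (con 2 :* t) := con 2 :* p :* t) refl (2 ^ d) (size T) ⟩
        2 ^ suc d * size T                        ∎

  -- The walk from `r` stops at the first vertex of either half, so the grafted path misses the
  -- other half. The half reached first supplies `X`; the other one plays `B` in `combine`.
  rank⇒tree : ∀ d {S r} → HasRank d S → r ∈ S → BigTree d S r
  rank⇒tree zero    {r = r} _ r∈S = leaf r , (λ { (here refl) → r∈S }) , ≤-refl
  rank⇒tree (suc d) {S} {r} (conn , A , B , A⊆S , B⊆S , dis , rankA , rankB) r∈S
    with rank⇒connected d rankA
  ... | ((a , a∈A) , _)
    with cut-at-first (λ x → (x ∈? A) ⊎-dec (x ∈? B)) (proj₂ conn r a r∈S (A⊆S a∈A)) (inj₁ a∈A)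
  ... | y , inj₁ y∈A , walk =
    let Tᵧ , Tᵧ⊆A , sizeTᵧ = rank⇒tree d rankA y∈A
        X , sizeX , subX = graft (λ ((_ , _ , e) , ∉) → e , ∉) walk Tᵧ (inj₁ ∘ Tᵧ⊆A)
    in combine d conn B⊆S (proj₁ (rank⇒connected d rankB)) (rank⇒tree d rankB) r∈S X
         (λ x∈ → [ (λ (_ , ((x∈S , _) , _)) → x∈S) , A⊆S ∘ Tᵧ⊆A ]′ (subX x∈))
         (λ x∈ x∈B → [ (λ (_ , (_ , x∉)) → x∉ (inj₂ x∈B)) , (λ x∈T → dis (Tᵧ⊆A x∈T) x∈B) ]′ (subX x∈))
         (≤-trans sizeTᵧ (*-monoʳ-≤ (2 ^ d) sizeX))
  ... | y , inj₂ y∈B , walk =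
    let Tᵧ , Tᵧ⊆B , sizeTᵧ = rank⇒tree d rankB y∈B
        X , sizeX , subX = graft (λ ((_ , _ , e) , ∉) → e , ∉) walk Tᵧ (inj₂ ∘ Tᵧ⊆B)
    in combine d conn A⊆S (proj₁ (rank⇒connected d rankA)) (rank⇒tree d rankA) r∈S X
         (λ x∈ → [ (λ (_ , ((x∈S , _) , _)) → x∈S) , B⊆S ∘ Tᵧ⊆B ]′ (subX x∈))
         (λ x∈ x∈A → [ (λ (_ , (_ , x∉)) → x∉ (inj₁ x∈A)) , (λ x∈T → dis x∈A (Tᵧ⊆B x∈T)) ]′ (subX x∈))
         (≤-trans sizeTᵧ (*-monoʳ-≤ (2 ^ d) sizeX))

  -- Routes in a tree and their signatures under a linear coloring

  -- A route leads from the root to a counted node; the label of a vertex records where it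
  -- continues (or that it ends), so routes separating at a vertex carry different labels there.
  Route : Set
  Route = List (Fin n × Bool)

  nodes : Route → List (Fin n)
  nodes = map proj₁

  routes : ∀ {r} → Tree r → List Route
  routes (leaf r)                 = ((r , false) ∷ []) ∷ []
  routes (one {r} _ T _)          = ((r , false) ∷ []) ∷ map ((r , true) ∷_) (routes T)
  routes (two {r} _ _ T T′ _ _ _) = map ((r , false) ∷_) (routes T) ++ map ((r , true) ∷_) (routes T′)

  length-routes : ∀ {r} (T : Tree r) → length (routes T) ≡ size T
  length-routes (leaf r)    = refl
  length-routes (one _ T _) = cong suc (trans (length-map _ (routes T)) (length-routes T))
  length-routes (two {r} _ _ T T′ _ _ _) = trans (length-++ (map ((r , false) ∷_) (routes T)))
    (cong₂ _+_ (trans (length-map _ (routes T)) (length-routes T)) (trans (length-map _ (routes T′)) (length-routes T′)))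

  record RouteFrom (r : Fin n) (X : List (Fin n)) (p : Route) : Set where
    constructor routeFrom
    field
      {rest}  : List (Fin n)
      nodes≡  : nodes p ≡ r ∷ rest
      isPath  : IsPath G (nodes p)
      nodes⊆  : ∀ {x} → x ∈ₗ nodes p → x ∈ₗ X

  extend-path : ∀ {r w X p} → r – w → r ∉ₗ X → RouteFrom w X p → IsPath G (r ∷ nodes p)
  extend-path {p = p} e r∉ (routeFrom eq (c , d) i) =
    subst (λ vs → Chain _–_ (_ ∷ vs)) (sym eq) (step e (subst (Chain _–_) eq c)) ,
    All.tabulate (λ { x∈ refl → r∉ (i x∈) }) ∷ d

  extend : ∀ {r w X Y p b} → r – w → r ∉ₗ X → (∀ {x} → x ∈ₗ X → x ∈ₗ Y) →
    RouteFrom w X p → RouteFrom r (r ∷ Y) ((r , b) ∷ p)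
  extend e r∉ X⊆Y ρ = routeFrom refl (extend-path e r∉ ρ)
    λ { (here x) → here x ; (there x) → there (X⊆Y (RouteFrom.nodes⊆ ρ x)) }

  routes-from : ∀ {r} (T : Tree r) → All (RouteFrom r (verts T)) (routes T)
  routes-from (leaf r) = routeFrom refl (one r , [] ∷ []) id ∷ []
  routes-from (one {r} e T r∉) =
    routeFrom refl (one r , [] ∷ []) (λ { (here x) → here x }) ∷
    All.map⁺ (All.map (extend e r∉ id) (routes-from T))
  routes-from (two e f T T′ r∉ r∉′ _) = All.++⁺
    (All.map⁺ (All.map (extend e r∉ ∈-++⁺ˡ) (routes-from T)))
    (All.map⁺ (All.map (extend f r∉′ (∈-++⁺ʳ (verts T))) (routes-from T′)))

  -- The induction moves the head of `xs` in front of `v ∷ ys`, where it becomes the new `v`; the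
  -- resulting path runs backwards along `xs`, through `v`, then along `ys`.
  path-through : ∀ {v} xs {ys} → IsPath G (v ∷ xs) → IsPath G (v ∷ ys) →
    (∀ {x} → x ∈ₗ xs → x ∉ₗ ys) → IsPath G (xs ʳ++ (v ∷ ys))
  path-through []       _ q _ = q
  path-through (x ∷ xs) (step e c , (a ∷ d)) (c′ , d′) dis =
    path-through xs (c , d) (step (sym~ G e) c′ , All.tabulate x≢ ∷ d′) dis′
    where
    x≢ : ∀ {y} → y ∈ₗ (_ ∷ _) → x ≢ y
    x≢ (here refl) refl = All.lookup a (here refl) refl
    x≢ (there y∈)  refl = dis (here refl) y∈
    dis′ : ∀ {y} → y ∈ₗ xs → y ∉ₗ (_ ∷ _)
    dis′ y∈ (here refl) = All.lookup a (there y∈) refl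
    dis′ y∈ (there y∈′) = dis (there y∈) y∈′

  ∈-ʳ++⁻ : ∀ xs {ys} {x : Fin n} → x ∈ₗ (xs ʳ++ ys) → x ∈ₗ xs ⊎ x ∈ₗ ys
  ∈-ʳ++⁻ []       x∈ = inj₂ x∈
  ∈-ʳ++⁻ (_ ∷ xs) x∈ with ∈-ʳ++⁻ xs x∈
  ... | inj₁ i           = inj₁ (there i)
  ... | inj₂ (here refl) = inj₁ (here refl)
  ... | inj₂ (there i)   = inj₂ i

  ∈-ʳ++⁺ : ∀ xs {ys} {x : Fin n} → x ∈ₗ xs ⊎ x ∈ₗ ys → x ∈ₗ (xs ʳ++ ys)
  ∈-ʳ++⁺ []       (inj₂ i)           = i
  ∈-ʳ++⁺ (_ ∷ xs) (inj₁ (here refl)) = ∈-ʳ++⁺ xs (inj₂ (here refl))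
  ∈-ʳ++⁺ (_ ∷ xs) (inj₁ (there i))   = ∈-ʳ++⁺ xs (inj₁ i)
  ∈-ʳ++⁺ (_ ∷ xs) (inj₂ i)           = ∈-ʳ++⁺ xs (inj₂ (there i))

  swap : Bool → Fin 3 → Fin 3
  swap false zero             = suc zero
  swap false (suc zero)       = zero
  swap false (suc (suc zero)) = suc (suc zero)
  swap true  zero             = suc (suc zero)
  swap true  (suc zero)       = suc zero
  swap true  (suc (suc zero)) = zero

  swap-involutive : ∀ b s → swap b (swap b s) ≡ s
  swap-involutive false zero             = refl
  swap-involutive false (suc zero)       = refl
  swap-involutive false (suc (suc zero)) = refl
  swap-involutive true  zero             = refl
  swap-involutive true  (suc zero)       = refl
  swap-involutive true  (suc (suc zero)) = refl

  swap-injective : ∀ b {s t} → swap b s ≡ swap b t → s ≡ t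
  swap-injective b {s} {t} eq = trans (sym (swap-involutive b s)) (trans (cong (swap b) eq) (swap-involutive b t))

  swap-zero : ∀ b → swap b zero ≢ zero
  swap-zero false ()
  swap-zero true  ()

  module Signature {k : ℕ} (col : Fin n → Fin k) where

    -- The vertex nearest the root acts last, so a common initial piece of two routes applies the
    -- same permutation to both and preserves any difference between them.
    sig : Fin k → Route → Fin 3
    sig c []            = zero
    sig c ((v , b) ∷ p) with col v ≟ c
    ... | yes _ = swap b (sig c p)
    ... | no  _ = sig c p

    Apart : Route → Route → Set
    Apart p q = ∃ λ c → sig c p ≢ sig c q

    apart-∷ : ∀ vb {p q} → Apart p q → Apart (vb ∷ p) (vb ∷ q)
    apart-∷ (v , b) {p} {q} (c , ne) = c , ne′
      where
      ne′ : sig c ((v , b) ∷ p) ≢ sig c ((v , b) ∷ q)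
      ne′ with col v ≟ c
      ... | yes _ = ne ∘ swap-injective b
      ... | no  _ = ne

    sig-absent : ∀ c p → (∀ {x} → x ∈ₗ nodes p → col x ≢ c) → sig c p ≡ zero
    sig-absent c []            _   = refl
    sig-absent c ((v , b) ∷ p) abs with col v ≟ c
    ... | yes eq = contradiction eq (abs (here refl))
    ... | no  _  = sig-absent c p (abs ∘ there)

    -- Only `u` acts on the coordinate `col u`, and a single swap moves zero.
    sig-centre : ∀ u p → Unique (nodes p) → u ∈ₗ nodes p →
      (∀ {x} → x ∈ₗ nodes p → col x ≡ col u → x ≡ u) → sig (col u) p ≢ zero
    sig-centre u ((v , b) ∷ p) (a ∷ d) u∈ centre with col v ≟ col u
    ... | yes eq rewrite sig-absent (col u) p
            (λ x∈ eq′ → All.lookup a x∈ (trans (centre (here refl) eq) (sym (centre (there x∈) eq′)))) = swap-zero b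
    sig-centre u ((v , b) ∷ p) (a ∷ d) (here refl) centre | no ne = contradiction refl ne
    sig-centre u ((v , b) ∷ p) (a ∷ d) (there u∈) centre  | no ne = sig-centre u p d u∈ (centre ∘ there)

    -- The centre u of the path through v meeting both routes tells them apart: it lies on just
    -- one of them, or u = v and the two swaps move zero differently.
    fork-apart : IsLinear G col → ∀ v p q → IsPath G (v ∷ nodes p) → IsPath G (v ∷ nodes q) →
      (∀ {x} → x ∈ₗ nodes p → x ∉ₗ nodes q) → Apart ((v , false) ∷ p) ((v , true) ∷ q)
    fork-apart lin v p q Pp@(_ , ap ∷ dp) Pq@(_ , aq ∷ dq) dis
      with lin (nodes p ʳ++ (v ∷ nodes q)) (path-through (nodes p) Pp Pq dis)
    ... | u , u∈ , centre = col u , ne (∈-ʳ++⁻ (nodes p) u∈)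
      where
      centreᵖ : ∀ {x} → x ∈ₗ nodes p → col x ≡ col u → x ≡ u
      centreᵖ x∈ = centre _ (∈-ʳ++⁺ (nodes p) (inj₁ x∈))
      centreᵛ : col v ≡ col u → v ≡ u
      centreᵛ = centre _ (∈-ʳ++⁺ (nodes p) (inj₂ (here refl)))
      centreᵠ : ∀ {x} → x ∈ₗ nodes q → col x ≡ col u → x ≡ u
      centreᵠ x∈ = centre _ (∈-ʳ++⁺ (nodes p) (inj₂ (there x∈)))
      ne : u ∈ₗ nodes p ⊎ u ∈ₗ (v ∷ nodes q) → sig (col u) ((v , false) ∷ p) ≢ sig (col u) ((v , true) ∷ q)
      ne i with col v ≟ col u
      ne i | yes eq with centreᵛ eq
      ... | refl rewrite sig-absent (col u) p (λ x∈ e → All.lookup ap x∈ (sym (centreᵖ x∈ e)))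
                       | sig-absent (col u) q (λ x∈ e → All.lookup aq x∈ (sym (centreᵠ x∈ e))) = λ ()
      ne (inj₁ u∈p) | no _ rewrite sig-absent (col u) q (λ x∈ e → dis (subst (_∈ₗ nodes p) (sym (centreᵠ x∈ e)) u∈p) x∈) =
        sig-centre u p dp u∈p centreᵖ
      ne (inj₂ (here refl)) | no ¬eq = contradiction refl ¬eq
      ne (inj₂ (there u∈q)) | no _ rewrite sig-absent (col u) p (λ x∈ e → dis x∈ (subst (_∈ₗ nodes q) (sym (centreᵖ x∈ e)) u∈q)) =
        sig-centre u q dq u∈q centreᵠ ∘ sym

    routes-apart : IsLinear G col → ∀ {r} (T : Tree r) → AllPairs Apart (routes T)
    routes-apart lin (leaf r) = [] ∷ []
    routes-apart lin (one {r} e T r∉) =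
      -- The route ending at `r` is treated as a fork at `r` with an empty branch.
      All.map⁺ (All.map (λ ρ → fork-apart lin r [] _ (one r , [] ∷ []) (extend-path e r∉ ρ) (λ ())) (routes-from T)) ∷
      AllPairs.map⁺ (AllPairs.map (apart-∷ (r , true)) (routes-apart lin T))
    routes-apart lin (two {r} e f T T′ r∉ r∉′ dis) = AllPairs.++⁺
      (AllPairs.map⁺ (AllPairs.map (apart-∷ (r , false)) (routes-apart lin T)))
      (AllPairs.map⁺ (AllPairs.map (apart-∷ (r , true)) (routes-apart lin T′)))
      (All.map⁺ (All.map (λ ρ → All.map⁺ (All.map (λ ρ′ →
        fork-apart lin r _ _ (extend-path e r∉ ρ) (extend-path f r∉′ ρ′)
          (λ x∈ x∈′ → dis (RouteFrom.nodes⊆ ρ x∈) (RouteFrom.nodes⊆ ρ′ x∈′)))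
        (routes-from T′))) (routes-from T)))

    size≤3^k : IsLinear G col → ∀ {r} (T : Tree r) → size T ≤ 3 ^ k
    size≤3^k lin T = subst (_≤ 3 ^ k) (trans (length-map code (routes T)) (length-routes T))
      (unique⇒length≤ (AllPairs.map⁺ (AllPairs.map (λ {p} {q} → code-apart {p} {q}) (routes-apart lin T))))
      where
      code : Route → Fin (3 ^ k)
      code p = funToFin (λ c → sig c p)
      code-apart : ∀ {p q} → Apart p q → code p ≢ code q
      code-apart {p} {q} (c , ne) eq = ne (begin
        sig c p              ≡⟨ finToFun-funToFin (λ c → sig c p) c ⟨
        finToFun (code p) c  ≡⟨ cong (λ i → finToFun i c) eq ⟩
        finToFun (code q) c  ≡⟨ finToFun-funToFin (λ c → sig c q) c ⟩
        sig c q              ∎)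
        where open ≡-Reasoning

  linear⇒rank-bound : ∀ {k} {col : Fin n → Fin k} → IsLinear G col →
    ∀ d {S} → HasRank d S → 3 ^ d ≤ 2 ^ d * 3 ^ k
  linear⇒rank-bound {col = col} lin d rank =
    let (r , r∈) , _ = rank⇒connected d rank
        T , _ , bound = rank⇒tree d rank r∈
    in ≤-trans bound (*-monoʳ-≤ (2 ^ d) (Signature.size≤3^k col lin T))

-- Centered colorings from tree decompositions

-- Double negation is applicative, so finitely many instances can be collected one after another.
¬¬-∀ : {P : Fin n → Set} → (∀ i → ¬ ¬ P i) → ¬ ¬ (∀ i → P i)
¬¬-∀ = sequence (RawMonad.rawApplicative ¬¬-Monad)

module _ {n : ℕ} {P : Fin n → Set} (P? : ∀ x → Dec (P x)) where

  comprehension : Subset n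
  comprehension = tabulate (λ x → does (P? x))

  ∈-comprehension⁺ : ∀ {x} → P x → x ∈ comprehension
  ∈-comprehension⁺ {x} px = lookup⇒[]= x _ (trans (lookup∘tabulate _ x) holds)
    where
    holds : does (P? x) ≡ inside
    holds with P? x
    ... | yes _  = refl
    ... | no ¬px = contradiction px ¬px

  ∈-comprehension⁻ : ∀ {x} → x ∈ comprehension → P x
  ∈-comprehension⁻ {x} x∈ with P? x | trans (sym (lookup∘tabulate (λ x → does (P? x)) x)) ([]=⇒lookup x∈)
  ... | yes px | _ = px
  ... | no _   | ()

x∉p─q : ∀ {x} (p q : Subset n) → x ∈ p ─ q → x ∉ q
x∉p─q (_ ∷ p) (inside  ∷ q) (there x∈) (there x∈q) = x∉p─q p q x∈ x∈q
x∉p─q (_ ∷ p) (outside ∷ q) (there x∈) (there x∈q) = x∉p─q p q x∈ x∈q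

-- Acyclic graphs

module Acyclic {m : ℕ} (T : Graph (suc m)) (acyclic : ∀ vs → ¬ IsCycle T vs) where

  private
    _∼_ : Fin (suc m) → Fin (suc m) → Set
    _∼_ = _~_ T

  -- Loop erasure leaves a simple path from `j` to `i`. It is not a single step, so together with
  -- the edge it closes up to a cycle.
  no-second-route : ∀ {i j} → i ∼ j →
    ¬ Walk (λ a b → a ∼ b × ¬ (a ≡ j × b ≡ i)) j i
  no-second-route {i} {j} e walk with erase-loops walk
  ... | simple []           c d refl = irrefl~ T e
  ... | simple (_ ∷ [])     (step (_ , ne) _) d refl = ne (refl , refl)
  ... | simple vs@(_ ∷ _ ∷ _) c d refl = acyclic (j ∷ vs) ((map-chain proj₁ c , d) , s≤s (s≤s (s≤s z≤n)) , e)

  -- Otherwise the orbit of f would be a non-backtracking walk, which closes up to a cycle.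
  two-cycle : (f : Fin (suc m) → Fin (suc m)) → (∀ i → i ∼ f i) → ∃ λ i → f (f i) ≡ i
  two-cycle f edge with any? (λ i → f (f i) ≟ i)
  ... | yes found = found
  -- The orbit would list `suc (suc m)` distinct vertices among `suc m`.
  ... | no none   = contradiction (orbit (suc m)) λ (_ , _ , p , len) →
          <⇒≱ (≤-reflexive (sym len)) (unique⇒length≤ (SimplePath.unique p))
    where
    -- The orbit is stored with its newest point first, so that applying `f` adds a new head.
    Back : Fin (suc m) → Fin (suc m) → Set
    Back a b = a ≡ f b

    back⇒edge : ∀ {a b} → Back a b → a ∼ b
    back⇒edge refl = sym~ T (edge _)

    no-return : ∀ {x} → ¬ SimplePath Back x (f x)
    no-return {x} (simple []       _ _ e) = irrefl~ T (subst (x ∼_) (sym e) (edge x))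
    no-return {x} (simple (_ ∷ []) (step b _) _ e) = none (x , sym (trans b (cong f e)))
    no-return {x} (simple vs@(_ ∷ _ ∷ _) c d e) =
      acyclic (x ∷ vs) ((map-chain back⇒edge c , d) , s≤s (s≤s (s≤s z≤n)) , subst (_∼ x) (sym e) (sym~ T (edge x)))

    orbit : ∀ l → ∃₂ λ x y → Σ (SimplePath Back x y) λ p → length (x ∷ SimplePath.rest p) ≡ suc l
    orbit zero = Fin.zero , _ , simple [] (one _) ([] ∷ []) refl , refl
    orbit (suc l) with orbit l
    ... | x , y , p@(simple vs c d e) , len with mem? _≟_ (f x) (x ∷ vs)
    ...   | yes i = contradiction (proj₁ (prefix-to p i)) no-return
    ...   | no ∉  = f x , y , simple (x ∷ vs) (step refl c) (All.tabulate (λ { i refl → ∉ i }) ∷ d) e , cong suc len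

-- The Helly property for connected sets in a tree decomposition

module Decomposed {n : ℕ} (G : Graph n) (D : TreeDecomposition G) where
  open Rank G
  open Acyclic (T D) (proj₂ (isTree D))

  private
    Node : Set
    Node = Fin (suc (m D))
    _∼_ : Node → Node → Set
    _∼_ = _~_ (T D)

  coherent-avoiding : ∀ {i j l x} → x ∉ bag D i → x ∈ bag D j →
    Walk (λ a b → a ∼ b × x ∈ bag D b) j l → Walk (Outside (_≡ i) _∼_) j l
  coherent-avoiding x∉ x∈ [] = []
  coherent-avoiding x∉ x∈ ((e , x∈′) ∷ w) =
    (e , (λ { refl → x∉ x∈ }) , (λ { refl → x∉ x∈′ })) ∷ coherent-avoiding x∉ x∈′ w

  -- The nodes whose bags contain a fixed vertex of `A` are joined by coherence, and consecutive
  -- vertices of the walk share a bag. None of the nodes passed is `i`, as its bag misses `A`.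
  trace-connected : ∀ {i A} → (∀ {x} → x ∈ A → x ∉ bag D i) → ∀ {x y j l} →
    Walk (Within A) x y → x ∈ A → x ∈ bag D j → y ∈ bag D l → Walk (Outside (_≡ i) _∼_) j l
  trace-connected miss [] x∈A x∈j y∈l = coherent-avoiding (miss x∈A) x∈j (coherent D _ _ _ x∈j y∈l)
  trace-connected miss ((x∈A , x′∈A , e) ∷ w) _ x∈j y∈l with edgeCover D _ _ e
  ... | h , x∈h , x′∈h =
    coherent-avoiding (miss x∈A) x∈j (coherent D _ _ _ x∈j x∈h) ◅◅ trace-connected miss w x′∈A x′∈h y∈l

  -- For `s` distinct from `i`, all bags meeting `A` sit in the component of `s` after deleting `i`
  -- from the tree.
  Towards : Subset n → Node → Node → Set
  Towards A i s = ∀ {x l} → x ∈ A → x ∈ bag D l → Walk (Outside (_≡ i) _∼_) s l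

  towards : ∀ {A i} → Connected A → (∀ {x} → x ∈ A → x ∉ bag D i) → ∃ λ s → i ∼ s × Towards A i s
  towards {A} {i} ((x₀ , x₀∈) , walks) miss with cover D x₀
  ... | l₀ , x₀∈l₀ with last-exit (_≟ i) (proj₁ (isTree D) i l₀) refl (λ { refl → miss x₀∈ x₀∈l₀ })
  ... | _ , s , refl , e , _ , w = s , e , λ x∈ x∈l →
    w ◅◅ trace-connected miss (walks _ _ x₀∈ x∈) x₀∈ x₀∈l₀ x∈l

  -- Let every node i point to its neighbour in the direction of A i. Two adjacent nodes
  -- pointing at each other have sets living on different sides of their edge.
  helly : (A : Node → Subset n) → (∀ i → Connected (A i)) →
    (∀ i {x} → x ∈ A i → x ∉ bag D i) → ¬ (∀ i j → Nonempty (A i ∩ A j))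
  helly A conn miss meet =
    let i , back        = two-cycle next edge
        j               = next i
        x , x∈          = meet i j
        x∈Aᵢ , x∈Aⱼ     = x∈p∩q⁻ (A i) (A j) x∈
        l , x∈l         = cover D x
    -- The part from `j` to `l` never meets `i` and the reversed part from `l` to `i` never meets
    -- `j`, so neither uses the step from `j` to `i`.
    in no-second-route (edge i)
         (map-walk (λ (e , _ , b≢i) → e , b≢i ∘ proj₂) (dir i x∈Aᵢ x∈l) ◅◅
          map-walk (λ (e , a≢j , _) → e , a≢j ∘ proj₁)
            (reverse-walk (λ (e , a≢ , b≢) → sym~ (T D) e , b≢ , a≢)
              (subst (λ h → Walk (Outside (_≡ j) _∼_) h l) back (dir j x∈Aⱼ x∈l))))
    where
    next : Node → Node
    next i = proj₁ (towards (conn i) (miss i))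
    edge : ∀ i → i ∼ next i
    edge i = proj₁ (proj₂ (towards (conn i) (miss i)))
    dir : ∀ i → Towards (A i) i (next i)
    dir i = proj₂ (proj₂ (towards (conn i) (miss i)))

-- Building centered colorings from smaller ones

module Colouring {n : ℕ} (G : Graph n) where
  open Rank G

  -- Colours are plain numbers, bounded on `S` only, so colorings can be patched together without
  -- converting between `Fin` types.
  Colourable : ℕ → Subset n → Set₁
  Colourable c S = Σ (Fin n → ℕ) λ col → (∀ {v} → v ∈ S → col v < c) ×
    (∀ (H : Subgraph G) → V H ⊆ S → IsConnected H →
      ∃ λ v → v ∈ V H × (∀ w → w ∈ V H → col w ≡ col v → w ≡ v))

  colourable-mono : ∀ {c c′ S S′} → c ≤ c′ → S′ ⊆ S → Colourable c S → Colourable c′ S′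
  colourable-mono le sub (col , bound , cen) =
    col , (λ v∈ → ≤-trans (bound (sub v∈)) le) , (λ H H⊆ → cen H (sub ∘ H⊆))

  -- The fresh colour `c` is used in `S` on `v` alone: subgraphs through `v` have centre `v`, the
  -- others keep their old centre.
  delete-vertex : ∀ {c S} v → Colourable c (S - v) → Colourable (suc c) S
  delete-vertex {c} {S} v (col , bound , cen) = col′ , bound′ , cen′
    where
    col′ : Fin n → ℕ
    col′ w with w ≟ v
    ... | yes _ = c
    ... | no _  = col w

    old : ∀ {w} → w ≢ v → col′ w ≡ col w
    old {w} ne with w ≟ v
    ... | yes eq = contradiction eq ne
    ... | no _   = refl

    new : col′ v ≡ c
    new with v ≟ v
    ... | yes _ = refl
    ... | no ne = contradiction refl ne

    bound′ : ∀ {w} → w ∈ S → col′ w < suc c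
    bound′ {w} w∈ with w ≟ v
    ... | yes _ = ≤-refl
    ... | no ne = m≤n⇒m≤1+n (bound (x∈p∧x≢y⇒x∈p-y w∈ ne))

    cen′ : ∀ H → V H ⊆ S → IsConnected H → _
    cen′ H H⊆ conn with v ∈? V H
    ... | yes v∈ = v , v∈ , unique
      where
      unique : ∀ w → w ∈ V H → col′ w ≡ col′ v → w ≡ v
      unique w w∈ eq with w ≟ v
      ... | yes w≡v = w≡v
      ... | no w≢v  = contradiction (trans eq new) (<⇒≢ (bound (x∈p∧x≢y⇒x∈p-y (H⊆ w∈) w≢v)))
    ... | no v∉ with cen H (λ w∈ → x∈p∧x≢y⇒x∈p-y (H⊆ w∈) (λ { refl → v∉ w∈ })) conn
    ...   | u , u∈ , unique = u , u∈ , λ w w∈ eq → unique w w∈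
              (trans (sym (old (λ { refl → v∉ w∈ }))) (trans eq (old (λ { refl → v∉ u∈ }))))

  -- Asking only for an inclusion into `S′` lets it stay fixed while `S` and `p` lose vertices, with
  -- no equations between subsets.
  delete-set : ∀ j {c S S′} p → ∣ p ∣ ≤ j → (∀ {x} → x ∈ S → x ∉ p → x ∈ S′) →
    Colourable c S′ → Colourable (j + c) S
  delete-set j p le sub C with nonempty? p
  ... | no empty = colourable-mono (m≤n+m _ j) (λ x∈ → sub x∈ (λ x∈p → empty (_ , x∈p))) C
  delete-set zero    p le sub C | yes (v , v∈) = contradiction (≤-trans (x∈p⇒∣p-x∣<∣p∣ v∈) le) λ ()
  delete-set (suc j) {S = S} p le sub C | yes (v , v∈) =
    delete-vertex v (delete-set j (p - v) (≤-pred (≤-trans (x∈p⇒∣p-x∣<∣p∣ v∈) le))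
      (λ x∈ x∉ → sub (p─q⊆p S ⁅ v ⁆ x∈) (λ x∈p → x∉ (x∈p∧x≢y⇒x∈p-y x∈p (λ { refl → x∉p─q S ⁅ v ⁆ x∈ (x∈⁅x⁆ v) })))) C)

  Closed : Subset n → Subset n → Set
  Closed S C = ∀ {a b} → Within S a b → a ∈ C → b ∈ C

  -- No edge inside `S` leaves `C`, so a connected subgraph lies on one side and both sides can
  -- share the same `c` colours.
  colourable-∪ : ∀ {c S C} → Closed S C → Colourable c C → Colourable c (S ─ C) → Colourable c S
  colourable-∪ {c} {S} {C} closed (col₁ , bound₁ , cen₁) (col₂ , bound₂ , cen₂) = col , bound , cen
    where
    col : Fin n → ℕ
    col w with w ∈? C
    ... | yes _ = col₁ w
    ... | no _  = col₂ w

    col-in : ∀ {w} → w ∈ C → col w ≡ col₁ w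
    col-in {w} w∈ with w ∈? C
    ... | yes _ = refl
    ... | no w∉ = contradiction w∈ w∉

    col-out : ∀ {w} → w ∉ C → col w ≡ col₂ w
    col-out {w} w∉ with w ∈? C
    ... | yes w∈ = contradiction w∈ w∉
    ... | no _   = refl

    bound : ∀ {w} → w ∈ S → col w < c
    bound {w} w∈S with w ∈? C
    ... | yes w∈ = bound₁ w∈
    ... | no w∉  = bound₂ (x∈p∧x∉q⇒x∈p─q w∈S w∉)

    cen : ∀ H → V H ⊆ S → IsConnected H → _
    cen H H⊆ conn@((h , h∈H) , walks) = split (h ∈? C)
      where
      stays : ∀ {a b} → Walk (E H) a b → a ∈ C → b ∈ C
      stays []      a∈ = a∈
      stays (e ∷ w) a∈ = let a∈H , b∈H = E-ends H e in stays w (closed (H⊆ a∈H , H⊆ b∈H , E⊆ H e) a∈)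

      split : Dec (h ∈ C) → _
      split (yes h∈) =
        let H⊆C : V H ⊆ C
            H⊆C w∈ = stays (walks _ _ h∈H w∈) h∈
            u , u∈ , unique = cen₁ H H⊆C conn
        in u , u∈ , λ w w∈ eq → unique w w∈ (trans (sym (col-in (H⊆C w∈))) (trans eq (col-in (H⊆C u∈))))
      split (no h∉) =
        let H∉C : ∀ {w} → w ∈ V H → w ∉ C
            H∉C w∈ w∈C = h∉ (stays (walks _ _ w∈ h∈H) w∈C)
            u , u∈ , unique = cen₂ H (λ w∈ → x∈p∧x∉q⇒x∈p─q (H⊆ w∈) (H∉C w∈)) conn
        in u , u∈ , λ w w∈ eq → unique w w∈ (trans (sym (col-out (H∉C w∈))) (trans eq (col-out (H∉C u∈))))

  NoRank : ℕ → Subset n → Set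
  NoRank d S = ∀ A → A ⊆ S → ¬ HasRank d A

  singleton-connected : ∀ v → Connected ⁅ v ⁆
  singleton-connected v = (v , x∈⁅x⁆ v) , walks
    where
    walks : ∀ a b → a ∈ ⁅ v ⁆ → b ∈ ⁅ v ⁆ → Walk (Within ⁅ v ⁆) a b
    walks a b a∈ b∈ with x∈⁅y⁆⇒x≡y v a∈ | x∈⁅y⁆⇒x≡y v b∈
    ... | refl | refl = []

  IsComponent : Subset n → Fin n → Subset n → Set
  IsComponent S v C = v ∈ C × C ⊆ S × Connected C × Closed S C

  -- Reachability is not decidable for an arbitrary edge relation, hence the double negation.
  component : ∀ S v → v ∈ S → ¬ ¬ ∃ (IsComponent S v)
  component S v v∈S = λ k → ¬¬-∀ (λ _ → ¬¬-excluded-middle) (k ∘ build)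
    where
    build : (∀ u → Dec (Walk (Within S) v u)) → ∃ (IsComponent S v)
    build reach? = C , ∈-comprehension⁺ reach? [] , C⊆S , ((v , ∈-comprehension⁺ reach? []) , walks) , closed
      where
      C : Subset n
      C = comprehension reach?
      C⊆S : C ⊆ S
      C⊆S u∈ = end∈ (∈-comprehension⁻ reach? u∈) v∈S
        where
        end∈ : ∀ {a b} → Walk (Within S) a b → a ∈ S → b ∈ S
        end∈ []                  a∈ = a∈
        end∈ ((_ , b∈ , _) ∷ w) _   = end∈ w b∈
      closed : Closed S C
      closed e a∈ = ∈-comprehension⁺ reach? (∈-comprehension⁻ reach? a∈ ◅◅ (e ∷ []))
      restrict : ∀ {a b} → Walk (Within S) a b → a ∈ C → Walk (Within C) a b
      restrict []      _  = []
      restrict (e@(_ , _ , adj) ∷ w) a∈ = (a∈ , closed e a∈ , adj) ∷ restrict w (closed e a∈)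
      walks : ∀ a b → a ∈ C → b ∈ C → Walk (Within C) a b
      walks a b a∈ b∈ = restrict (reverse-walk within-sym (∈-comprehension⁻ reach? a∈) ◅◅ ∈-comprehension⁻ reach? b∈) a∈

  module _ (D : TreeDecomposition G) {t : ℕ} (small : BagsAtMost D t) where
    open Decomposed G D

    -- If every bag missed some set of rank `d`, these sets would meet pairwise, since two disjoint
    -- ones give `C` rank `suc d`; this contradicts `helly`. Selecting one set per node is possible
    -- only under a double negation.
    hitting-bag : ∀ d {C} → Connected C → NoRank (suc d) C → ¬ ¬ (∃ λ i → NoRank d (C ─ bag D i))
    hitting-bag d {C} conn none ¬hit = ¬¬-∀ missed λ A →
      helly (proj₁ ∘ A) (λ i → rank⇒connected d (proj₂ (proj₂ (proj₂ (A i)))))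
        (λ i → proj₁ (proj₂ (proj₂ (A i)))) (meet A)
      where
      Missed : Fin _ → Set
      Missed i = ∃ λ A → A ⊆ C × (∀ {x} → x ∈ A → x ∉ bag D i) × HasRank d A

      missed : ∀ i → ¬ ¬ Missed i
      missed i ¬missed = ¬hit (i , λ A A⊆ rank →
        ¬missed (A , p─q⊆p C (bag D i) ∘ A⊆ , x∉p─q C (bag D i) ∘ A⊆ , rank))

      meet : (A : ∀ i → Missed i) → ∀ i j → Nonempty (proj₁ (A i) ∩ proj₁ (A j))
      meet A i j with nonempty? (proj₁ (A i) ∩ proj₁ (A j))
      ... | yes ne = ne
      ... | no ¬ne =
        let Aᵢ , Aᵢ⊆ , _ , rᵢ = A i
            Aⱼ , Aⱼ⊆ , _ , rⱼ = A j
        in ⊥-elim (none C id (conn , Aᵢ , Aⱼ , Aᵢ⊆ , Aⱼ⊆ , (λ x∈ x∈′ → ¬ne (_ , x∈p∩q⁺ (x∈ , x∈′))) , rᵢ , rⱼ))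

    noRank⇒colourable : ∀ d S → NoRank d S → ¬ ¬ Colourable (d * t) S
    noRank⇒colourable zero S none k = k ((λ _ → 0) , (λ v∈ → ⊥-elim (empty v∈)) , λ H H⊆ ((v , v∈) , _) → ⊥-elim (empty (H⊆ v∈)))
      where
      empty : ∀ {v} → v ∉ S
      -- Singletons have rank 0, so the absence of rank 0 forces `S` to be empty.
      empty {v} v∈ = none ⁅ v ⁆ (λ x∈ → subst (_∈ S) (sym (x∈⁅y⁆⇒x≡y v x∈)) v∈) (singleton-connected v)
    noRank⇒colourable (suc d) S none = by-components n S (∣p∣≤n S) none
      where
      -- An inner induction on a bound for the cardinality splits off one component at a time; the
      -- rank bound stays the same.
      by-components : ∀ j S → ∣ S ∣ ≤ j → NoRank (suc d) S → ¬ ¬ Colourable (suc d * t) S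
      by-components j S le none k with nonempty? S
      ... | no empty = k ((λ _ → 0) , (λ v∈ → ⊥-elim (empty (_ , v∈))) , λ H H⊆ ((v , v∈) , _) → ⊥-elim (empty (v , H⊆ v∈)))
      by-components zero    S le none k | yes (v , v∈) = contradiction (≤-trans (x∈p⇒∣p-x∣<∣p∣ v∈) le) λ ()
      by-components (suc j) S le none k | yes (v , v∈) =
        component S v v∈ λ (C , v∈C , C⊆S , conn , closed) →
        hitting-bag d conn (λ A A⊆ → none A (C⊆S ∘ A⊆)) λ (i , none′) →
        noRank⇒colourable d (C ─ bag D i) none′ λ colC′ →
        by-components j (S ─ C)
          (≤-pred (≤-trans (p∩q≢∅⇒∣p─q∣<∣p∣ S C (v , x∈p∩q⁺ (v∈ , v∈C))) le))
          (λ A A⊆ → none A (p─q⊆p S C ∘ A⊆)) λ colRest →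
        -- The bag costs `t` colours on top of `d * t`, and the rest of `S` reuses them all.
        k (colourable-∪ closed (delete-set t (bag D i) (small i) x∈p∧x∉q⇒x∈p─q colC′) colRest)

  colourable⇒centered : ∀ {c} → Colourable c ⊤ → Σ (Fin n → Fin c) (IsCentered G)
  colourable⇒centered (col , bound , cen) = (λ v → fromℕ< (bound (∈⊤ {x = v}))) , λ H conn →
    let v , v∈ , unique = cen H ⊆⊤ conn
    in v , v∈ , λ w w∈ eq → unique w w∈ (fromℕ<-injective (col w) (col v) (bound ∈⊤) (bound ∈⊤) eq)

-- Numerical estimates

^-cancelˡ-≤ : ∀ {m k l} → 1 < m → m ^ k ≤ m ^ l → k ≤ l
^-cancelˡ-≤ {m} {k} {l} 1<m le = ≮⇒≥ λ l<k → <⇒≱ (^-monoʳ-< m 1<m l<k) le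

exponent≤ : ∀ {x} p c → 2 ^ (3 + p) ≤ x → x < 2 ^ (4 + c) → p ≤ c
exponent≤ p c le lt = ≮⇒≥ λ c<p → <⇒≱ lt (≤-trans (^-monoʳ-≤ 2 (+-monoʳ-≤ 3 c<p)) le)

*-self-cancel-≤ : ∀ {x y} → x * x ≤ y * y → x ≤ y
*-self-cancel-≤ le = ≮⇒≥ λ y<x → <⇒≱ (*-mono-< y<x y<x) le

-- Rests on 2^3 ≤ 3^2.
log3≥3/2 : ∀ a b → Log3LeFrac a b → 3 * b ≤ 2 * a
log3≥3/2 a b le = ^-cancelˡ-≤ ≤-refl (begin
  2 ^ (3 * b)   ≡⟨ ^-*-assoc 2 3 b ⟨
  8 ^ b         ≤⟨ ^-monoˡ-≤ b (n≤1+n 8) ⟩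
  9 ^ b         ≡⟨ ^-*-assoc 3 2 b ⟩
  3 ^ (2 * b)   ≡⟨ cong (3 ^_) (*-comm 2 b) ⟩
  3 ^ (b * 2)   ≡⟨ ^-*-assoc 3 b 2 ⟨
  (3 ^ b) ^ 2   ≤⟨ ^-monoˡ-≤ 2 le ⟩
  (2 ^ a) ^ 2   ≡⟨ ^-*-assoc 2 a 2 ⟩
  2 ^ (a * 2)   ≡⟨ cong (2 ^_) (*-comm a 2) ⟩
  2 ^ (2 * a)   ∎)
  where open ≤-Reasoning

-- The right side is 8φ^q = 4 `lucas q` + 4√5 `fib q` with √5 replaced by 9/4.
fib-lucas : ∀ q → fib (6 + q) ≡ 4 * lucas q + 9 * fib q
fib-lucas zero          = refl
fib-lucas (suc zero)    = refl
fib-lucas (suc (suc q)) = trans (cong₂ _+_ (fib-lucas (suc q)) (fib-lucas q))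
  (solve 4 (λ l l′ f f′ → (con 4 :* l′ :+ con 9 :* f′) :+ (con 4 :* l :+ con 9 :* f)
      := con 4 :* (l′ :+ l) :+ con 9 :* (f′ :+ f)) refl (lucas q) (lucas (suc q)) (fib q) (fib (suc q)))
  where open +-*-Solver

fib-mono : ∀ q → fib q ≤ fib (suc q)
fib-mono zero          = z≤n
fib-mono (suc zero)    = ≤-refl
fib-mono (suc (suc q)) = m≤m+n _ _

-- Four Fibonacci steps gain at most a factor 2^3; this is the source of the slope 3/4 in
-- `fib-power`.
fib-+4 : ∀ q → fib (5 + q) ≤ 8 * fib (suc q)
fib-+4 q = begin
  fib (5 + q)                        ≡⟨ solve 2 (λ x y → ((x :+ y) :+ x) :+ (x :+ y) :+ ((x :+ y) :+ x) := con 5 :* x :+ con 3 :* y) refl x y ⟩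
  5 * x + 3 * y                      ≤⟨ +-monoʳ-≤ (5 * x) (*-monoʳ-≤ 3 (fib-mono q)) ⟩
  5 * x + 3 * x                      ≡⟨ *-distribʳ-+ x 5 3 ⟨
  8 * x                              ∎
  where
  open ≤-Reasoning
  open +-*-Solver
  x = fib (suc q)
  y = fib q

-- Rests on √5 ≤ 9/4.
phi-power⇒fib : ∀ p q → TwoPowLePhiPow p q → 2 ^ (3 + p) ≤ fib (6 + q)
phi-power⇒fib p q le = begin
  2 ^ (3 + p)                          ≡⟨ ^-distribˡ-+-* 2 2 (suc p) ⟩
  4 * 2 ^ suc p                        ≤⟨ *-monoʳ-≤ 4 (m≤n+m∸n (2 ^ suc p) (lucas q)) ⟩
  4 * (lucas q + X)                    ≡⟨ *-distribˡ-+ 4 (lucas q) X ⟩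
  4 * lucas q + 4 * X                  ≤⟨ +-monoʳ-≤ (4 * lucas q) (*-self-cancel-≤ square) ⟩
  4 * lucas q + 9 * fib q              ≡⟨ fib-lucas q ⟨
  fib (6 + q)                          ∎
  where
  open ≤-Reasoning
  open +-*-Solver
  X = 2 ^ suc p ∸ lucas q
  square : (4 * X) * (4 * X) ≤ (9 * fib q) * (9 * fib q)
  square = begin
    (4 * X) * (4 * X)             ≡⟨ solve 1 (λ x → (con 4 :* x) :* (con 4 :* x) := con 16 :* (x :* x)) refl X ⟩
    16 * (X * X)                  ≤⟨ *-monoʳ-≤ 16 le ⟩
    16 * (5 * (fib q * fib q))    ≡⟨ *-assoc 16 5 (fib q * fib q) ⟨
    80 * (fib q * fib q)          ≤⟨ *-monoˡ-≤ (fib q * fib q) (n≤1+n 80) ⟩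
    81 * (fib q * fib q)          ≡⟨ solve 1 (λ f → con 81 :* (f :* f) := (con 9 :* f) :* (con 9 :* f)) refl (fib q) ⟩
    (9 * fib q) * (9 * fib q)     ∎

-- Induction lowering `q` by 4 and `p` by 3. In the base cases, 8, 13, 21 and 34 are the values of
-- `fib` at 6 to 9.
fib-power : ∀ p q → 2 ^ (3 + p) ≤ fib (6 + q) → 4 * p ≤ 3 * q
fib-power p 0 le = ≤-trans (*-monoʳ-≤ 4 (exponent≤ p 0 le (from-yes (8 <? 16)))) z≤n
fib-power p 1 le = ≤-trans (*-monoʳ-≤ 4 (exponent≤ p 0 le (from-yes (13 <? 16)))) z≤n
fib-power p 2 le = ≤-trans (*-monoʳ-≤ 4 (exponent≤ p 1 le (from-yes (21 <? 32)))) (from-yes (4 ≤? 6))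
fib-power p 3 le = ≤-trans (*-monoʳ-≤ 4 (exponent≤ p 2 le (from-yes (34 <? 64)))) (from-yes (8 ≤? 9))
fib-power 0 (suc (suc (suc (suc q)))) le = z≤n
fib-power 1 (suc (suc (suc (suc q)))) le = ≤-trans (from-yes (4 ≤? 12)) (*-monoʳ-≤ 3 (m≤m+n 4 q))
fib-power 2 (suc (suc (suc (suc q)))) le = ≤-trans (from-yes (8 ≤? 12)) (*-monoʳ-≤ 3 (m≤m+n 4 q))
fib-power (suc (suc (suc p))) (suc (suc (suc (suc q)))) le = begin
  4 * (3 + p)  ≡⟨ *-distribˡ-+ 4 3 p ⟩
  12 + 4 * p   ≤⟨ +-monoʳ-≤ 12 (fib-power p q (*-cancelˡ-≤ 8 scaled)) ⟩
  12 + 3 * q   ≡⟨ *-distribˡ-+ 3 4 q ⟨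
  3 * (4 + q)  ∎
  where
  open ≤-Reasoning
  scaled : 8 * 2 ^ (3 + p) ≤ 8 * fib (6 + q)
  scaled = begin
    8 * 2 ^ (3 + p)  ≡⟨ ^-distribˡ-+-* 2 3 (3 + p) ⟨
    2 ^ (6 + p)      ≤⟨ le ⟩
    fib (10 + q)     ≤⟨ fib-+4 (5 + q) ⟩
    8 * fib (6 + q)  ∎

-- Rests on (3/2)^3 ≥ 3, in the form 8 ≤ 9; the additional factor 3/2 makes the inequality strict.
rank-limit : ∀ L → ¬ (3 ^ suc (3 * L) ≤ 2 ^ suc (3 * L) * 3 ^ L)
rank-limit L = <⇒≱ (begin-strict
  2 ^ suc (3 * L) * 3 ^ L      ≡⟨ cong (λ x → 2 * x * 3 ^ L) (^-*-assoc 2 3 L) ⟨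
  2 * 8 ^ L * 3 ^ L            ≡⟨ *-assoc 2 (8 ^ L) (3 ^ L) ⟩
  2 * (8 ^ L * 3 ^ L)          ≤⟨ *-monoʳ-≤ 2 (*-monoˡ-≤ (3 ^ L) (^-monoˡ-≤ L (n≤1+n 8))) ⟩
  2 * (9 ^ L * 3 ^ L)          ≡⟨ cong (λ x → 2 * (x * 3 ^ L)) (^-*-assoc 3 2 L) ⟩
  2 * (3 ^ (2 * L) * 3 ^ L)    ≡⟨ cong (2 *_) (^-distribˡ-+-* 3 (2 * L) L) ⟨
  2 * 3 ^ (2 * L + L)          ≡⟨ cong (λ x → 2 * 3 ^ x) (+-comm (2 * L) L) ⟩
  2 * 3 ^ (3 * L)              <⟨ *-monoˡ-< (3 ^ (3 * L)) {{m^n≢0 3 (3 * L)}} (n<1+n 2) ⟩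
  3 ^ suc (3 * L)              ∎)
  where open ≤-Reasoning

-- With u = a/b and v = p/q, it suffices that 3v ≤ 9/4 ≤ u² for the coefficient of `L` and v ≤ 1 ≤ u
-- for the constant term.
cen-bound : ∀ {k t L} → k ≤ suc (3 * L) * t → CenBound k t L
cen-bound {k} {t} {L} k≤ a b p q _ _ log3 phi = begin
  k * p * (b * b)                             ≤⟨ *-monoˡ-≤ (b * b) (*-monoˡ-≤ p k≤) ⟩
  suc (3 * L) * t * p * (b * b)               ≡⟨ solve 4 (λ L t p b → (con 1 :+ con 3 :* L) :* t :* p :* (b :* b) := t :* (L :* (con 3 :* p :* (b :* b)) :+ (p :* b) :* b)) refl L t p b ⟩
  t * (L * (3 * p * (b * b)) + p * b * b)     ≤⟨ *-monoʳ-≤ t (+-mono-≤ (*-monoʳ-≤ L main) (*-monoˡ-≤ b (*-mono-≤ p≤q b≤a))) ⟩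
  t * (L * (q * (a * a)) + q * a * b)         ≡⟨ solve 5 (λ L t q a b → t :* (L :* (q :* (a :* a)) :+ q :* a :* b) := q :* a :* t :* (L :* a :+ b)) refl L t q a b ⟩
  q * a * t * (L * a + b)                     ∎
  where
  open ≤-Reasoning
  open +-*-Solver
  4p≤3q : 4 * p ≤ 3 * q
  4p≤3q = fib-power p q (phi-power⇒fib p q phi)
  3b≤2a : 3 * b ≤ 2 * a
  3b≤2a = log3≥3/2 a b log3
  p≤q : p ≤ q
  p≤q = *-cancelˡ-≤ 4 (≤-trans 4p≤3q (*-monoˡ-≤ q (n≤1+n 3)))
  b≤a : b ≤ a
  b≤a = *-cancelˡ-≤ 3 (≤-trans 3b≤2a (*-monoˡ-≤ a (n≤1+n 2)))
  main : 3 * p * (b * b) ≤ q * (a * a)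
  main = *-cancelˡ-≤ 4 (begin
    4 * (3 * p * (b * b))        ≡⟨ solve 2 (λ p b → con 4 :* (con 3 :* p :* (b :* b)) := con 4 :* p :* (con 3 :* (b :* b))) refl p b ⟩
    4 * p * (3 * (b * b))        ≤⟨ *-monoˡ-≤ (3 * (b * b)) 4p≤3q ⟩
    3 * q * (3 * (b * b))        ≡⟨ solve 2 (λ q b → con 3 :* q :* (con 3 :* (b :* b)) := q :* ((con 3 :* b) :* (con 3 :* b))) refl q b ⟩
    q * ((3 * b) * (3 * b))      ≤⟨ *-monoʳ-≤ q (*-mono-≤ 3b≤2a 3b≤2a) ⟩
    q * ((2 * a) * (2 * a))      ≡⟨ solve 2 (λ q a → q :* ((con 2 :* a) :* (con 2 :* a)) := con 4 :* (q :* (a :* a))) refl q a ⟩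
    4 * (q * (a * a))            ∎)

theorem3p5 : ∀ {n} (G : Graph n) (k t L : ℕ) →
    IsChiCen G k → IsTwPlusOne G t → IsChiLin G L → CenBound k t L
theorem3p5 G k t L (_ , k-min) ((D , small) , _) ((_ , lin) , _) =
  -- The coloring exists only under a double negation, which suffices because the inequality on `k`
  -- is decidable.
  cen-bound {k} {t} {L} (decidable-stable (k ≤? suc (3 * L) * t) λ ¬bound →
    noRank⇒colourable D small (suc (3 * L)) ⊤
      (λ A _ rank → rank-limit L (linear⇒rank-bound lin (suc (3 * L)) rank))
      (¬bound ∘ k-min _ ∘ colourable⇒centered))
  where
  open Rank G
  open Colouring G
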